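{- Let $q\ge 1$ be an integer. For each integer $n\ge 0$, let $a_q(n)$ be the number of arrangements of black and white beads on a necklace with a total of $n$ beads satisfying the following: (i) there is at least one black bead; (ii) between any two (cyclically consecutive) black beads the number of white beads is divisible by $q$; (iii) rotations and flippings of a necklace are considered distinct. Then $a_q(0)=0$, $a_q(1)=\cdots=a_q(q)=1$, and for $n\ge q+1$ $$a_q(n)=\begin{cases} a_q(n-1)+a_q(n-q)+q & \text{if } n\equiv 1 \pmod q,\\ a_q(n-1)+a_q(n-q) & \text{otherwise.}\end{cases}$$
   Context: A necklace on $n$ beads is a coloring, black or white, of the $n$ positions $1,2,\ldots,n$ arranged cyclically (position $1$ at the top, positions increasing clockwise, position $n$ adjacent to position $1$). Since rotations and flippings are considered distinct, necklaces are counted as functions from the set of labelled positions to $\{\text{black},\text{white}\}$. Condition (ii) is read cyclically: for each black bead, the number of white beads strictly between it and the next black bead encountered clockwise must be divisible by $q$. If there is exactly one black bead, the next black bead is that bead itself, so there are $n-1$ white beads between the black bead and itself, and condition (ii) requires $q\mid n-1$. -}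

module Defs where

open import Data.Fin.Base using (Fin; toℕ)
open import Data.Fin.Properties using (all?; any?; nonZeroIndex)
open import Data.List.Base using (List; []; _∷_; cartesianProductWith; filter; length)
open import Data.List.Membership.Propositional using (_∈_)
open import Data.List.Membership.Propositional.Properties using (∈-cartesianProductWith⁺)
open import Data.List.Relation.Unary.All using ([]; _∷_)
open import Data.List.Relation.Unary.AllPairs using ([]; _∷_)
open import Data.List.Relation.Unary.Any using (here; there)
open import Data.List.Relation.Unary.Unique.Propositional using (Unique)
open import Data.List.Relation.Unary.Unique.Propositional.Properties using (cartesianProductWith⁺)
open import Data.Nat.Base using (ℕ; zero; suc; _+_)
open import Data.Nat.Divisibility using (_∣_; _∣?_)
open import Data.Nat.DivMod using (_mod_)
open import Data.Product.Base using (_×_; _,_; ∃)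
open import Data.Vec.Base using (Vec; []; _∷_; lookup)
open import Data.Vec.Properties using (∷-injective)
open import Relation.Binary.Definitions using (DecidableEquality)
open import Relation.Binary.PropositionalEquality using (_≡_; refl)
open import Relation.Nullary.Decidable using (Dec; yes; no; _×-dec_; _→-dec_)

data Bead : Set where
  black white : Bead

infix 4 _≟_

_≟_ : DecidableEquality Bead
black ≟ black = yes refl
black ≟ white = no λ ()
white ≟ black = no λ ()
white ≟ white = yes refl

-- Positions are labelled 0, …, n ∸ 1 clockwise; two necklaces differing by a
-- rotation or a reflection are different vectors.
Necklace : ℕ → Set
Necklace n = Vec Bead n

clockwise : ∀ {n} → Fin n → ℕ → Fin n
clockwise {n} i k = ((toℕ i + k) mod n) {{nonZeroIndex i}}

-- The first black bead met when moving clockwise from position i (excluding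
-- the starting point, but possibly returning to it after a full turn) comes
-- after exactly g white beads.
WhitesToNextBlack : ∀ {n} → Necklace n → Fin n → ℕ → Set
WhitesToNextBlack w i g =
  (∀ (k : Fin g) → lookup w (clockwise i (suc (toℕ k))) ≡ white) ×
  lookup w (clockwise i (suc g)) ≡ black

HasBlack : ∀ {n} → Necklace n → Set
HasBlack {n} w = ∃ λ (i : Fin n) → lookup w i ≡ black

-- Starting from a black bead, a black bead is met after at most n steps, so g
-- ranges over 0, …, n ∸ 1; g = n ∸ 1 is the case of a single black bead.
GapsDivisibleBy : ∀ {n} → ℕ → Necklace n → Set
GapsDivisibleBy {n} q w =
  ∀ (i : Fin n) → lookup w i ≡ black →
  ∀ (g : Fin n) → WhitesToNextBlack w i (toℕ g) → q ∣ toℕ g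

Admissible : ∀ {n} → ℕ → Necklace n → Set
Admissible q w = HasBlack w × GapsDivisibleBy q w

whitesToNextBlack? : ∀ {n} (w : Necklace n) (i : Fin n) (g : ℕ) →
                     Dec (WhitesToNextBlack w i g)
whitesToNextBlack? w i g =
  all? (λ k → lookup w (clockwise i (suc (toℕ k))) ≟ white) ×-dec
  (lookup w (clockwise i (suc g)) ≟ black)

admissible? : ∀ {n} (q : ℕ) (w : Necklace n) → Dec (Admissible q w)
admissible? q w =
  any? (λ i → lookup w i ≟ black) ×-dec
  all? (λ i → (lookup w i ≟ black) →-dec
  all? (λ g → whitesToNextBlack? w i (toℕ g) →-dec (q ∣? toℕ g)))

beads : List Bead
beads = black ∷ white ∷ []

necklaces : ∀ n → List (Necklace n)
necklaces zero    = [] ∷ []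
necklaces (suc n) = cartesianProductWith _∷_ beads (necklaces n)

∈-necklaces : ∀ {n} (w : Necklace n) → w ∈ necklaces n
∈-necklaces []      = here refl
∈-necklaces (b ∷ w) = ∈-cartesianProductWith⁺ _∷_ (∈-beads b) (∈-necklaces w)
  where
  ∈-beads : ∀ b → b ∈ beads
  ∈-beads black = here refl
  ∈-beads white = there (here refl)

necklaces-unique : ∀ n → Unique (necklaces n)
necklaces-unique zero    = [] ∷ []
necklaces-unique (suc n) =
  cartesianProductWith⁺ _∷_ ∷-injective
    (((λ ()) ∷ []) ∷ [] ∷ []) (necklaces-unique n)

a : ℕ → ℕ → ℕ
a q n = length (filter (admissible? q) (necklaces n))

{-# OPTIONS --safe #-}
-- Read a necklace clockwise from position 0 by an automaton that remembers the
-- number s of white beads before the first black bead and the number c of white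
-- beads since the last black bead: a black bead requires q ∣ c, and the end of
-- the word closes a gap of c + s white beads. From a black bead, either the next
-- bead is black or the next q beads are white, so the number of accepted
-- continuations of length n satisfies u(n) = u(n-1) + u(n-q) for n ≥ q. Summing
-- over s, only the necklaces whose single black bead is in one of the last q
-- positions escape this recurrence: there are q of them if q ∣ n - 1, else none.
module Submission where

open import Defs
open import Data.Nat.Base using (ℕ; _+_; _∸_; _≤_; NonZero)
open import Data.Nat.DivMod using (_%_)
open import Data.Product.Base using (_×_)
open import Relation.Binary.PropositionalEquality using (_≡_)
open import Relation.Nullary.Negation using (¬_)

open import Data.Bool.Base using (true; false)
open import Data.Empty using (⊥)
open import Data.Fin.Base using (Fin; toℕ; fromℕ<; zero; suc)
open import Data.Fin.Properties using (toℕ<n; toℕ-fromℕ<; toℕ-injective; fromℕ<-cong)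
open import Data.List.Base using ([]; _∷_; _++_; filter; length; map)
open import Data.List.Properties using (filter-++; filter-≐; filter-none; length-++; ++-identityʳ)
open import Data.List.Relation.Unary.All using (universal)
open import Data.Nat.Base using (zero; suc; _*_; _<_; z≤n; z<s)
open import Data.Nat.DivMod
  using (_mod_; _/_; m%n<n; m<n⇒m%n≡m; [m+n]%n≡m%n; m≡m%n+[m/n]*n; %-remove-+ʳ)
open import Data.Nat.Divisibility
  using (_∣_; _∣?_; _∣0; ∣-refl; ∣m+n∣m⇒∣n; ∣m∣n⇒∣m+n; >⇒∤; n∣m*n)
open import Data.Nat.Properties hiding (_≟_)
open import Data.Nat.Tactic.RingSolver using (solve-∀)
open import Data.Product.Base using (_,_; ∃; proj₁; proj₂)
open import Data.Sum.Base using (inj₁; inj₂)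
open import Data.Vec.Base using ([]; _∷_; lookup)
open import Function.Base using (_∘_)
open import Level using (0ℓ)
open import Relation.Binary.Definitions using (tri<; tri≈; tri>)
open import Relation.Binary.PropositionalEquality
  using (refl; sym; trans; cong; cong₂; subst; module ≡-Reasoning)
open import Relation.Nullary.Decidable using (yes; no; does; _×-dec_)
open import Relation.Nullary.Negation using (contradiction)
open import Relation.Unary using (Pred; Decidable; _≐_)

black≢white : ∀ {b} → b ≡ black → ¬ (b ≡ white)
black≢white refl ()

-- The automaton reading a necklace.

Tail : ℕ → ℕ → ℕ → ∀ {n} → Necklace n → Set
Tail q s c []          = q ∣ c + s
Tail q s c (black ∷ w) = q ∣ c × Tail q s 0 w
Tail q s c (white ∷ w) = Tail q s (suc c) w

Lead : ℕ → ℕ → ∀ {n} → Necklace n → Set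
-- No black bead has been met by the end of the word, so this clause encodes condition (i).
Lead q s []          = ⊥
Lead q s (black ∷ w) = Tail q s 0 w
Lead q s (white ∷ w) = Lead q (suc s) w

tail? : ∀ q s c {n} → Decidable (Tail q s c {n})
tail? q s c []          = q ∣? c + s
tail? q s c (black ∷ w) = (q ∣? c) ×-dec tail? q s 0 w
tail? q s c (white ∷ w) = tail? q s (suc c) w

lead? : ∀ q s {n} → Decidable (Lead q s {n})
lead? q s []          = no λ ()
lead? q s (black ∷ w) = tail? q s 0 w
lead? q s (white ∷ w) = lead? q (suc s) w

-- Admissibility as acceptance by the automaton

module _ (x : ℕ → Bead) where

  WhiteFrom : ℕ → ℕ → Set
  WhiteFrom k c = ∀ {i} → i < c → x (k + i) ≡ white

  NextBlack : ℕ → ℕ → Set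
  NextBlack j g = WhiteFrom (suc j) g × x (suc j + g) ≡ black

  GapDivisible : ℕ → ℕ → Set
  GapDivisible q j = ∀ g → NextBlack j g → q ∣ g

  GapsDivisibleIn : ℕ → ℕ → ℕ → Set
  GapsDivisibleIn q k n = ∀ {j} → k ≤ j → j < n → x j ≡ black → GapDivisible q j

  Agrees : ∀ {m} → ℕ → Necklace m → Set
  Agrees {m} k w = ∀ (i : Fin m) → x (k + toℕ i) ≡ lookup w i

  NextBlack-unique : ∀ {j g h} → NextBlack j g → NextBlack j h → g ≡ h
  NextBlack-unique {g = g} {h} (wg , bg) (wh , bh) with <-cmp g h
  ... | tri< g<h _ _ = contradiction (wh g<h) (black≢white bg)
  ... | tri≈ _ g≡h _ = g≡h
  ... | tri> _ _ h<g = contradiction (wg h<g) (black≢white bh)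

  -- The gap after a position is unique, so one witness settles the universal statement.
  gapDivisible : ∀ {q j g} → q ∣ g → NextBlack j g → GapDivisible q j
  gapDivisible {q} q∣g nb h nb′ = subst (q ∣_) (NextBlack-unique nb nb′) q∣g

  agrees-head : ∀ {m k b} {w : Necklace m} → Agrees k (b ∷ w) → x k ≡ b
  agrees-head {k = k} ag = trans (cong x (sym (+-identityʳ k))) (ag zero)

  agrees-tail : ∀ {m k b} {w : Necklace m} → Agrees k (b ∷ w) → Agrees (suc k) w
  agrees-tail {k = k} ag i = trans (cong x (sym (+-suc k (toℕ i)))) (ag (suc i))

  whiteFrom-++ : ∀ k {c d} → WhiteFrom k c → WhiteFrom (k + c) d → WhiteFrom k (c + d)
  whiteFrom-++ k {c} {d} wc wd {i} i<c+d with <-≤-connex i c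
  ... | inj₁ i<c = wc i<c
  ... | inj₂ c≤i = trans (cong x k+i≡) (wd (+-cancelˡ-< c _ _ (subst (_< c + d) i≡ i<c+d)))
    where
    i≡ : i ≡ c + (i ∸ c)
    i≡ = sym (m+[n∸m]≡n c≤i)
    k+i≡ : k + i ≡ k + c + (i ∸ c)
    k+i≡ = trans (cong (k +_) i≡) (sym (+-assoc k c (i ∸ c)))

  whiteFrom-suc : ∀ k {c} → WhiteFrom k c → x (k + c) ≡ white → WhiteFrom k (suc c)
  whiteFrom-suc k wc e {i} i<1+c with m<1+n⇒m<n∨m≡n i<1+c
  ... | inj₁ i<c  = wc i<c
  ... | inj₂ refl = e

  -- The hypotheses describe the start of the second turn, where the `s` leading white beads and the
  -- first black bead come again. They turn the gap left open at the end of the word into an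
  -- interval of `x`.
  module _ (q : ℕ) {n s : ℕ} (ws : WhiteFrom n s) (bs : x (n + s) ≡ black) where

    nextBlack-wrap : ∀ {b c} → suc b + c ≡ n → WhiteFrom (suc b) c → NextBlack b (c + s)
    nextBlack-wrap {b} {c} refl wc =
      whiteFrom-++ (suc b) wc ws , trans (cong x (sym (+-assoc (suc b) c s))) bs

    -- Induction on the unread word `w`, with the invariant that `b` is the last black bead, `c`
    -- white beads follow it and `k` is the next position. The gap after `b` is still open, so it is
    -- stated apart from the gaps starting at `k` or later.
    tail⇒gaps : ∀ {m k b c} (w : Necklace m) → k + m ≡ n → suc b + c ≡ k → Agrees k w →
                WhiteFrom (suc b) c → Tail q s c w → GapDivisible q b × GapsDivisibleIn q k n
    tail⇒gaps {k = k} [] k+0≡n b+c≡k ag wc t =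
      gapDivisible t (nextBlack-wrap (trans b+c≡k k≡n) wc) ,
      λ k≤j j<n → contradiction (<-≤-trans j<n (subst (_≤ _) k≡n k≤j)) (<-irrefl refl)
      where
      k≡n : k ≡ n
      k≡n = trans (sym (+-identityʳ k)) k+0≡n
    tail⇒gaps {suc m} {k} {b} {c} (white ∷ w) k+m≡n refl ag wc t =
      proj₁ ih , λ k≤j j<n xj → proj₂ ih (≤∧≢⇒< k≤j λ { refl → black≢white xj (agrees-head ag) }) j<n xj
      where
      ih = tail⇒gaps w (trans (sym (+-suc k m)) k+m≡n) (+-suc (suc b) c) (agrees-tail ag)
             (whiteFrom-suc (suc b) wc (agrees-head ag)) t
    tail⇒gaps {suc m} {k} (black ∷ w) k+m≡n refl ag wc (q∣c , t) =
      gapDivisible q∣c (wc , agrees-head ag) , gaps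
      where
      -- The bead at `k` becomes the last black bead, with `c = 0`; the first component of `ih` then
      -- settles its own gap.
      ih = tail⇒gaps {b = k} w (trans (sym (+-suc k m)) k+m≡n) (+-identityʳ (suc k)) (agrees-tail ag)
             (λ ()) t
      gaps : GapsDivisibleIn q k n
      gaps k≤j j<n xj with m≤n⇒m<n∨m≡n k≤j
      ... | inj₁ k<j  = proj₂ ih k<j j<n xj
      ... | inj₂ refl = proj₁ ih

    gaps⇒tail : ∀ {m k b c} (w : Necklace m) → k + m ≡ n → suc b + c ≡ k → Agrees k w →
                WhiteFrom (suc b) c → GapDivisible q b → GapsDivisibleIn q k n → Tail q s c w
    gaps⇒tail {k = k} [] k+0≡n b+c≡k ag wc gap gaps =
      gap _ (nextBlack-wrap (trans b+c≡k (trans (sym (+-identityʳ k)) k+0≡n)) wc)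
    gaps⇒tail {suc m} {k} {b} {c} (white ∷ w) k+m≡n refl ag wc gap gaps =
      gaps⇒tail w (trans (sym (+-suc k m)) k+m≡n) (+-suc (suc b) c) (agrees-tail ag)
        (whiteFrom-suc (suc b) wc (agrees-head ag)) gap (gaps ∘ <⇒≤)
    gaps⇒tail {suc m} {k} {b} (black ∷ w) k+m≡n refl ag wc gap gaps =
      gap _ (wc , agrees-head ag) ,
      gaps⇒tail w (trans (sym (+-suc k m)) k+m≡n) (+-identityʳ (suc k)) (agrees-tail ag) (λ ())
        (gaps ≤-refl (subst (k <_) k+m≡n (m<m+n k z<s)) (agrees-head ag)) (gaps ∘ <⇒≤)

  module _ (q : ℕ) {n : ℕ} (periodic : ∀ i → x (n + i) ≡ x i) where

    -- No gap starts before the first black bead. Once that bead is read, periodicity copies it and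
    -- the white prefix to position `n`, which is what `tail⇒gaps` requires of the second turn.
    lead⇒gaps : ∀ {m s} (w : Necklace m) → s + m ≡ n → Agrees s w → WhiteFrom 0 s → Lead q s w →
                (∃ λ j → j < n × x j ≡ black) × GapsDivisibleIn q 0 n
    lead⇒gaps {suc m} {s} (white ∷ w) s+m≡n ag ws l =
      lead⇒gaps w (trans (sym (+-suc s m)) s+m≡n) (agrees-tail ag)
        (whiteFrom-suc 0 ws (agrees-head ag)) l
    lead⇒gaps {suc m} {s} (black ∷ w) s+m≡n ag ws t =
      (s , subst (s <_) s+m≡n (m<m+n s z<s) , agrees-head ag) , gaps
      where
      tl = tail⇒gaps q (λ i<s → trans (periodic _) (ws i<s)) (trans (periodic s) (agrees-head ag))
             {b = s} w (trans (sym (+-suc s m)) s+m≡n) (+-identityʳ (suc s)) (agrees-tail ag) (λ ()) t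
      gaps : GapsDivisibleIn q 0 n
      gaps {j} _ j<n xj with <-cmp s j
      ... | tri< s<j _ _  = proj₂ tl s<j j<n xj
      ... | tri≈ _ refl _ = proj₁ tl
      ... | tri> _ _ j<s  = contradiction (ws j<s) (black≢white xj)

    gaps⇒lead : ∀ {m s} (w : Necklace m) → s + m ≡ n → Agrees s w → WhiteFrom 0 s →
                (∃ λ j → j < n × x j ≡ black) → GapsDivisibleIn q 0 n → Lead q s w
    gaps⇒lead {s = s} [] s+0≡n ag ws (j , j<n , xj) gaps =
      black≢white xj (ws (subst (j <_) (trans (sym s+0≡n) (+-identityʳ s)) j<n))
    gaps⇒lead {suc m} {s} (white ∷ w) s+m≡n ag ws hb gaps =
      gaps⇒lead w (trans (sym (+-suc s m)) s+m≡n) (agrees-tail ag)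
        (whiteFrom-suc 0 ws (agrees-head ag)) hb gaps
    gaps⇒lead {suc m} {s} (black ∷ w) s+m≡n ag ws hb gaps =
      gaps⇒tail q (λ i<s → trans (periodic _) (ws i<s)) (trans (periodic s) (agrees-head ag))
        {b = s} w (trans (sym (+-suc s m)) s+m≡n) (+-identityʳ (suc s)) (agrees-tail ag) (λ ())
        (gaps z≤n (subst (s <_) s+m≡n (m<m+n s z<s)) (agrees-head ag)) (λ _ → gaps z≤n)

-- Unrolling a necklace into a periodic sequence.

module _ {m : ℕ} (w : Necklace (suc m)) where

  private
    n = suc m

  -- Since `clockwise i k` is `(toℕ i + k) mod n`, the lookups in `WhitesToNextBlack` are values of
  -- `unroll` by definition, and cyclic gaps become intervals.
  unroll : ℕ → Bead
  unroll k = lookup w (k mod n)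

  mod-toℕ : ∀ (i : Fin n) → toℕ i mod n ≡ i
  mod-toℕ i = toℕ-injective (trans (toℕ-fromℕ< (m%n<n (toℕ i) n)) (m<n⇒m%n≡m (toℕ<n i)))

  unroll-agrees : Agrees unroll 0 w
  unroll-agrees i = cong (lookup w) (mod-toℕ i)

  unroll-periodic : ∀ i → unroll (n + i) ≡ unroll i
  unroll-periodic i = cong (lookup w)
    (fromℕ<-cong _ _ (trans (cong (_% n) (+-comm n i)) ([m+n]%n≡m%n i n)) (m%n<n (n + i) n) (m%n<n i n))

  whites⇒nextBlack : ∀ i {g} → WhitesToNextBlack w i g → NextBlack unroll (toℕ i) g
  whites⇒nextBlack i {g} (ws , b) =
    (λ {k} k<g → trans (cong unroll (sym (trans (cong (λ h → toℕ i + suc h) (toℕ-fromℕ< k<g)) (+-suc (toℕ i) k))))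
                   (ws (fromℕ< k<g))) ,
    trans (cong unroll (sym (+-suc (toℕ i) g))) b

  nextBlack⇒whites : ∀ i {g} → NextBlack unroll (toℕ i) g → WhitesToNextBlack w i g
  nextBlack⇒whites i {g} (ws , b) =
    (λ k → trans (cong unroll (+-suc (toℕ i) (toℕ k))) (ws (toℕ<n k))) ,
    trans (cong unroll (+-suc (toℕ i) g)) b

  -- After a full turn from a black bead the same bead is met again.
  nextBlack-< : ∀ {j g} → unroll j ≡ black → NextBlack unroll j g → g < n
  nextBlack-< {j} {g} b (ws , _) with <-≤-connex g n
  ... | inj₁ g<n = g<n
  ... | inj₂ n≤g = contradiction (ws n≤g)
    (black≢white (trans (cong unroll (trans (sym (+-suc j m)) (+-comm j n))) (trans (unroll-periodic j) b)))

  admissible⇒lead : ∀ {q} → Admissible q w → Lead q 0 w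
  admissible⇒lead {q} ((i , b) , gaps) =
    gaps⇒lead unroll q unroll-periodic w refl unroll-agrees (λ ())
      (toℕ i , toℕ<n i , trans (unroll-agrees i) b)
      (λ {j} _ j<n xj → subst (GapDivisible unroll q) (toℕ-fromℕ< j<n)
        (gap (fromℕ< j<n) (trans (cong unroll (toℕ-fromℕ< j<n)) xj)))
    where
    gap : ∀ j → unroll (toℕ j) ≡ black → GapDivisible unroll q (toℕ j)
    -- `GapsDivisibleBy` takes gaps from `Fin n`, `GapDivisible` from all natural numbers; the bound
    -- `nextBlack-<` bridges the two.
    gap j b g nb = subst (q ∣_) g≡
      (gaps j (trans (sym (unroll-agrees j)) b) (fromℕ< g<n)
        (subst (WhitesToNextBlack w j) (sym g≡) (nextBlack⇒whites j nb)))
      where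
      g<n = nextBlack-< b nb
      g≡ = toℕ-fromℕ< g<n

  lead⇒admissible : ∀ {q} → Lead q 0 w → Admissible q w
  lead⇒admissible {q} l with lead⇒gaps unroll q unroll-periodic w refl unroll-agrees (λ ()) l
  ... | (j , _ , xj) , gaps = (j mod n , xj) ,
    λ i b g nb → gaps z≤n (toℕ<n i) (trans (unroll-agrees i) b) (toℕ g) (whites⇒nextBlack i nb)

-- Counting accepted words

count : ∀ {n} {P : Pred (Necklace n) 0ℓ} → Decidable P → ℕ
count {n} P? = length (filter P? (necklaces n))

length-filter-map : ∀ {A B : Set} {P : Pred B 0ℓ} (P? : Decidable P) (f : A → B) xs →
                    length (filter P? (map f xs)) ≡ length (filter (P? ∘ f) xs)
length-filter-map P? f [] = refl
length-filter-map P? f (x ∷ xs) with does (P? (f x))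
... | true  = cong suc (length-filter-map P? f xs)
... | false = length-filter-map P? f xs

count-∷ : ∀ n {P : Pred (Necklace (suc n)) 0ℓ} (P? : Decidable P) →
          count P? ≡ count (P? ∘ (black ∷_)) + count (P? ∘ (white ∷_))
count-∷ n P? = begin
  -- The product with the two-element list of beads unfolds to two blocks and a final empty list.
  length (filter P? (bs ++ ws ++ []))                 ≡⟨ cong (λ v → length (filter P? (bs ++ v))) (++-identityʳ ws) ⟩
  length (filter P? (bs ++ ws))                       ≡⟨ cong length (filter-++ P? bs ws) ⟩
  length (filter P? bs ++ filter P? ws)               ≡⟨ length-++ (filter P? bs) ⟩
  length (filter P? bs) + length (filter P? ws)       ≡⟨ cong₂ _+_ (length-filter-map P? (black ∷_) (necklaces n))
                                                                   (length-filter-map P? (white ∷_) (necklaces n)) ⟩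
  count (P? ∘ (black ∷_)) + count (P? ∘ (white ∷_))   ∎
  where
  open ≡-Reasoning
  bs = map (black ∷_) (necklaces n)
  ws = map (white ∷_) (necklaces n)

count-≐ : ∀ n {P Q : Pred (Necklace n) 0ℓ} (P? : Decidable P) (Q? : Decidable Q) →
          P ≐ Q → count P? ≡ count Q?
count-≐ n P? Q? P≐Q = cong length (filter-≐ P? Q? P≐Q (necklaces n))

count-none : ∀ n {P : Pred (Necklace n) 0ℓ} (P? : Decidable P) →
             (∀ w → ¬ P w) → count P? ≡ 0
count-none n P? ¬P = cong length (filter-none P? (universal ¬P (necklaces n)))

-- Transitions of the automaton, as equations between counts.

tails : ℕ → ℕ → ℕ → ℕ → ℕ
tails q s c n = count (tail? q s c {n})

leads : ℕ → ℕ → ℕ → ℕ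
leads q s n = count (lead? q s {n})

-- The Iverson bracket [q ∣ d], as the number of accepted words of length 0.
δ : ℕ → ℕ → ℕ
δ q d = tails q d 0 0

tails-zero : ∀ q s c → tails q s c 0 ≡ δ q (c + s)
tails-zero q s c = count-≐ 0 (tail? q s c) (tail? q (c + s) 0)
  ((λ { {[]} t → t }) , (λ { {[]} t → t }))

δ-∣ : ∀ {q d} → q ∣ d → δ q d ≡ 1
δ-∣ {q} {d} q∣d with q ∣? d
... | yes _ = refl
... | no q∤d = contradiction q∣d q∤d

δ-∤ : ∀ {q d} → ¬ q ∣ d → δ q d ≡ 0
δ-∤ {q} {d} = λ q∤d → count-none 0 (tail? q d 0) λ { [] → q∤d }

a≡leads : ∀ q n → a q n ≡ leads q 0 n
a≡leads q zero    = refl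
a≡leads q (suc n) = count-≐ (suc n) (admissible? q) (lead? q 0)
  ((λ {w} → admissible⇒lead w) , (λ {w} → lead⇒admissible w))

leads-suc : ∀ q s n → leads q s (suc n) ≡ tails q s 0 n + leads q (suc s) n
leads-suc q s n = count-∷ n (lead? q s)

tails-∣ : ∀ {q s c} n → q ∣ c → tails q s c (suc n) ≡ tails q s 0 n + tails q s (suc c) n
tails-∣ {q} {s} {c} n q∣c = trans (count-∷ n (tail? q s c))
  (cong (_+ tails q s (suc c) n) (count-≐ n _ (tail? q s 0) (proj₂ , (q∣c ,_))))

tails-∤ : ∀ {q s c} n → ¬ q ∣ c → tails q s c (suc n) ≡ tails q s (suc c) n
tails-∤ {q} {s} {c} n q∤c = trans (count-∷ n (tail? q s c))
  (cong (_+ tails q s (suc c) n) (count-none n (λ w → tail? q s c (black ∷ w)) λ _ → q∤c ∘ proj₁))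

-- A count strictly between 0 and `q` is not divisible by `q` and forbids a black bead, so the next
-- `m` beads are forced to be white.
tails-skip : ∀ {q s} m c .{{_ : NonZero c}} n → m + c ≤ q → tails q s c (m + n) ≡ tails q s (m + c) n
tails-skip zero c n _ = refl
tails-skip {q} {s} (suc m) c n 1+m+c≤q = begin
  tails q s c (suc (m + n))    ≡⟨ tails-∤ (m + n) (>⇒∤ (m+n≤o⇒n≤o m m+1+c≤q)) ⟩
  tails q s (suc c) (m + n)    ≡⟨ tails-skip m (suc c) n m+1+c≤q ⟩
  tails q s (m + suc c) n      ≡⟨ cong (λ d → tails q s d n) (+-suc m c) ⟩
  tails q s (suc (m + c)) n    ∎
  where
  open ≡-Reasoning
  m+1+c≤q : m + suc c ≤ q
  m+1+c≤q = subst (_≤ q) (sym (+-suc m c)) 1+m+c≤q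

-- The counter enters only through divisibility tests by `q`, so the state matters only modulo `q`.
tail-+ˡ : ∀ {q s c n} (w : Necklace n) → Tail q s c w → Tail q s (q + c) w
tail-+ˡ {q} {s} {c} [] t = subst (q ∣_) (sym (+-assoc q c s)) (∣m∣n⇒∣m+n ∣-refl t)
tail-+ˡ (black ∷ w) (q∣c , t) = ∣m∣n⇒∣m+n ∣-refl q∣c , t
tail-+ˡ {q} {s} {c} (white ∷ w) t = subst (λ d → Tail q s d w) (+-suc q c) (tail-+ˡ w t)

tail-+ˡ⁻ : ∀ {q s c n} (w : Necklace n) → Tail q s (q + c) w → Tail q s c w
tail-+ˡ⁻ {q} {s} {c} [] t = ∣m+n∣m⇒∣n (subst (q ∣_) (+-assoc q c s) t) ∣-refl
tail-+ˡ⁻ (black ∷ w) (q∣c , t) = ∣m+n∣m⇒∣n q∣c ∣-refl , t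
tail-+ˡ⁻ {q} {s} {c} (white ∷ w) t = tail-+ˡ⁻ w (subst (λ d → Tail q s d w) (sym (+-suc q c)) t)

tails-+ˡ : ∀ q s c n → tails q s (q + c) n ≡ tails q s c n
tails-+ˡ q s c n = count-≐ n (tail? q s (q + c)) (tail? q s c)
  ((λ {w} → tail-+ˡ⁻ w) , (λ {w} → tail-+ˡ w))

-- Recurrences in the length of the word, for `q = p + 1`.

module _ (p : ℕ) where

  private
    q = suc p

    u : ℕ → ℕ → ℕ
    u = λ s n → tails q s 0 n

    S : ℕ → ℕ → ℕ
    S = leads q

  -- After a first white bead the word is too short to complete `q` white beads, so only the
  -- all-white word remains, subject to the closing test.
  u-suc-< : ∀ s {j} → suc j < q → u s (suc j) ≡ u s j + δ q (suc j + s)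
  u-suc-< s {j} 1+j<q = trans (tails-∣ j (q ∣0)) (cong (u s j +_) (begin
    tails q s 1 j        ≡⟨ cong (tails q s 1) (sym (+-identityʳ j)) ⟩
    tails q s 1 (j + 0)  ≡⟨ tails-skip j 1 0 (subst (_≤ q) (+-comm 1 j) (<⇒≤ 1+j<q)) ⟩
    tails q s (j + 1) 0  ≡⟨ tails-zero q s (j + 1) ⟩
    δ q (j + 1 + s)      ≡⟨ cong (λ d → δ q (d + s)) (+-comm j 1) ⟩
    δ q (suc j + s)      ∎))
    where open ≡-Reasoning

  -- A first white bead forces `p` more; the counter is then `q`, which is equivalent to 0.
  u-rec : ∀ s n → u s (q + n) ≡ u s (p + n) + u s n
  u-rec s n = trans (tails-∣ (p + n) (q ∣0)) (cong (u s (p + n) +_) (begin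
    tails q s 1 (p + n)  ≡⟨ tails-skip p 1 n (≤-reflexive (+-comm p 1)) ⟩
    tails q s (p + 1) n  ≡⟨ cong (λ d → tails q s d n) (trans (+-comm p 1) (sym (+-identityʳ q))) ⟩
    tails q s (q + 0) n  ≡⟨ tails-+ˡ q s 0 n ⟩
    u s n                ∎))
    where open ≡-Reasoning

  -- With at most `q` beads the black ones are adjacent. Dropping one of several black beads gives
  -- the first summand; the second counts the positions of a single black bead, whose gap is `j + s`
  -- wherever it stands. The induction varies `s`, as a leading white bead trades `j` for `s` and
  -- keeps `j + s` fixed.
  leads-suc-< : ∀ s {j} → j < q → S s (suc j) ≡ S s j + suc j * δ q (j + s)
  leads-suc-< s {zero} _ = trans (leads-suc q s 0) (swap (δ q s))
    where
    swap : ∀ d → d + 0 ≡ 0 + 1 * d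
    swap = solve-∀
  leads-suc-< s {suc j} 1+j<q = begin
    S s (2 + j)                                       ≡⟨ leads-suc q s (suc j) ⟩
    u s (suc j) + S (suc s) (suc j)                   ≡⟨ cong₂ _+_ (u-suc-< s 1+j<q) (leads-suc-< (suc s) (<⇒≤ 1+j<q)) ⟩
    u s j + d + (S (suc s) j + suc j * δ q (j + suc s)) ≡⟨ cong (λ e → u s j + d + (S (suc s) j + suc j * δ q e)) (+-suc j s) ⟩
    u s j + d + (S (suc s) j + suc j * d)             ≡⟨ rearrange (u s j) (S (suc s) j) j d ⟩
    u s j + S (suc s) j + (2 + j) * d                 ≡⟨ cong (_+ (2 + j) * d) (leads-suc q s j) ⟨
    S s (suc j) + (2 + j) * d                         ∎
    where
    open ≡-Reasoning
    d = δ q (suc j + s)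
    rearrange : ∀ a b j d → a + d + (b + suc j * d) ≡ a + b + suc (suc j) * d
    rearrange = solve-∀

  -- Splitting off the first bead, the black case obeys `u-rec` without correction, and the white
  -- case passes the correction on unchanged because `p + m + s` is preserved. The correction thus
  -- comes from the base case alone.
  leads-rec : ∀ s m → S s (q + m) ≡ S s (p + m) + S s m + q * δ q (p + m + s)
  leads-rec s zero rewrite +-identityʳ p =
    -- At `m = 0` all `q` positions can hold the single black bead; the added `S s 0` computes to 0.
    trans (leads-suc-< s (n<1+n p)) (cong (_+ q * δ q (p + s)) (sym (+-identityʳ (S s p))))
  leads-rec s (suc m) rewrite +-suc p m = begin
    S s (suc (q + m))                                 ≡⟨ leads-suc q s (q + m) ⟩
    u s (q + m) + S (suc s) (q + m)                   ≡⟨ cong₂ _+_ (u-rec s m) (leads-rec (suc s) m) ⟩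
    u s (p + m) + u s m + (S (suc s) (p + m) + S (suc s) m + q * δ q (p + m + suc s))
      ≡⟨ cong (λ e → u s (p + m) + u s m + (S (suc s) (p + m) + S (suc s) m + q * δ q e)) (+-suc (p + m) s) ⟩
    u s (p + m) + u s m + (S (suc s) (p + m) + S (suc s) m + qd)
      ≡⟨ rearrange (u s (p + m)) (u s m) (S (suc s) (p + m)) (S (suc s) m) qd ⟩
    u s (p + m) + S (suc s) (p + m) + (u s m + S (suc s) m) + qd
      ≡⟨ cong (_+ qd) (cong₂ _+_ (leads-suc q s (p + m)) (leads-suc q s m)) ⟨
    S s (suc (p + m)) + S s (suc m) + qd              ∎
    where
    open ≡-Reasoning
    qd = q * δ q (suc (p + m) + s)
    rearrange : ∀ a b c d e → a + b + (c + d + e) ≡ a + c + (b + d) + e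
    rearrange = solve-∀

  a-rec : ∀ m → a q (q + m) ≡ a q (p + m) + a q m + q * δ q (p + m)
  a-rec m = begin
    a q (q + m)                                    ≡⟨ a≡leads q (q + m) ⟩
    S 0 (q + m)                                    ≡⟨ leads-rec 0 m ⟩
    S 0 (p + m) + S 0 m + q * δ q (p + m + 0)      ≡⟨ cong (λ e → S 0 (p + m) + S 0 m + q * δ q e) (+-identityʳ (p + m)) ⟩
    S 0 (p + m) + S 0 m + q * δ q (p + m)          ≡⟨ cong (_+ q * δ q (p + m)) (cong₂ _+_ (a≡leads q (p + m)) (a≡leads q m)) ⟨
    a q (p + m) + a q m + q * δ q (p + m)          ∎
    where open ≡-Reasoning

  -- The value is 1 at length one and stays there, since the later corrections test numbers strictly
  -- between 0 and `q`.
  leads-≤ : ∀ {j} → j < q → S 0 (suc j) ≡ 1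
  leads-≤ {zero}  0<q = trans (leads-suc-< 0 0<q) (cong (1 *_) (δ-∣ (q ∣0)))
  leads-≤ {suc j} 1+j<q = begin
    S 0 (2 + j)                                      ≡⟨ leads-suc-< 0 1+j<q ⟩
    S 0 (suc j) + (2 + j) * δ q (suc j + 0)          ≡⟨ cong₂ (λ e d → e + (2 + j) * d) (leads-≤ (<⇒≤ 1+j<q)) δ≡0 ⟩
    1 + (2 + j) * 0                                  ≡⟨ cong suc (*-zeroʳ (2 + j)) ⟩
    1                                                ∎
    where
    open ≡-Reasoning
    δ≡0 : δ q (suc j + 0) ≡ 0
    δ≡0 = δ-∤ (subst (λ d → ¬ q ∣ d) (sym (+-identityʳ (suc j))) (>⇒∤ 1+j<q))

-- Residues modulo `q` and the final case distinction.

[1+k]%n≡1%n⇒n∣k : ∀ k n .{{_ : NonZero n}} → suc k % n ≡ 1 % n → n ∣ k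
-- The division identities for `1 + k` and for `1` are compared and the common remainder is
-- cancelled. Keeping `1 / n * n` covers `n = 1`, where that term is not zero.
[1+k]%n≡1%n⇒n∣k k n eq = ∣m+n∣m⇒∣n (subst (n ∣_) (+-cancelˡ-≡ (1 % n) _ _ (begin
  1 % n + suc k / n * n                ≡⟨ cong (_+ suc k / n * n) eq ⟨
  suc k % n + suc k / n * n            ≡⟨ m≡m%n+[m/n]*n (suc k) n ⟨
  1 + k                                ≡⟨ cong (_+ k) (m≡m%n+[m/n]*n 1 n) ⟩
  1 % n + 1 / n * n + k                ≡⟨ +-assoc (1 % n) (1 / n * n) k ⟩
  1 % n + (1 / n * n + k)              ∎)) (n∣m*n (suc k / n))) (n∣m*n (1 / n))
  where open ≡-Reasoning

theorem1 : ∀ (q : ℕ) .{{_ : NonZero q}} →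
    (a q 0 ≡ 0) ×
    (∀ (n : ℕ) → 1 ≤ n → n ≤ q → a q n ≡ 1) ×
    (∀ (n : ℕ) → q + 1 ≤ n →
    (n % q ≡ 1 % q → a q n ≡ a q (n ∸ 1) + a q (n ∸ q) + q) ×
    (¬ (n % q ≡ 1 % q) → a q n ≡ a q (n ∸ 1) + a q (n ∸ q)))
theorem1 q@(suc p) = refl , small , large
  where
  small : ∀ n → 1 ≤ n → n ≤ q → a q n ≡ 1
  small (suc j) _ j<q = trans (a≡leads q (suc j)) (leads-≤ p j<q)

  shifted : ∀ m → (suc (p + m) % q ≡ 1 % q → a q (q + m) ≡ a q (p + m) + a q m + q) ×
                  (¬ (suc (p + m) % q ≡ 1 % q) → a q (q + m) ≡ a q (p + m) + a q m)
  shifted m =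
    (λ eq → trans (a-rec p m) (cong (a q (p + m) + a q m +_)
      (trans (cong (q *_) (δ-∣ ([1+k]%n≡1%n⇒n∣k (p + m) q eq))) (*-identityʳ q)))) ,
    (λ neq → trans (a-rec p m) (trans (cong (a q (p + m) + a q m +_)
      (trans (cong (q *_) (δ-∤ (neq ∘ %-remove-+ʳ 1))) (*-zeroʳ q))) (+-identityʳ _)))

  large : ∀ n → q + 1 ≤ n →
          (n % q ≡ 1 % q → a q n ≡ a q (n ∸ 1) + a q (n ∸ q) + q) ×
          (¬ (n % q ≡ 1 % q) → a q n ≡ a q (n ∸ 1) + a q (n ∸ q))
  large n q<n with m≤n⇒∃[o]m+o≡n (≤-trans (m≤m+n q 1) q<n)
  -- With `n = q + m`, `n ∸ 1` computes to `p + m`, but `n ∸ q` equals `m` only propositionally,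
  -- hence the transport.
  ... | m , refl = subst (λ k → (suc (p + m) % q ≡ 1 % q → a q (q + m) ≡ a q (p + m) + a q k + q) ×
                                (¬ (suc (p + m) % q ≡ 1 % q) → a q (q + m) ≡ a q (p + m) + a q k))
                     (sym (m+n∸m≡n q m)) (shifted m)
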